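{- For integers $k, n \geq 0$ let $S(k,n)$ be the maximum cardinality of a locally $k$-wide family of segments of $[n]$. Then $S$ satisfies the recursive equations $$S(k,0) = 1 \ (k \geq 0), \qquad S(0,n) = 1 \ (n \geq 0), \qquad S(k,1) = 2 \ \text{ for } k \geq 1,$$ $$S(k,n) = 2n - 1 + S(k-1, n-2) \ \text{ for } k \geq 1 \text{ and } n \geq 2.$$
   Context: $[n] = \{1,2,\dots,n\}$ (so $[0]=\emptyset$). A segment of $[n]$ is a subset of the form $[i,j] = \{m \in \mathbf{Z} \mid i \leq m \leq j\} \subseteq [n]$; the empty set is a segment. A family $\mathcal{F}$ of subsets of a finite set $X$ is locally $k$-wide iff for every $x \in X$ every antichain (with respect to inclusion) of $\{U \in \mathcal{F} \mid x \in U\}$ has at most $k$ members. -}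

module Defs where

open import Data.Fin using (Fin; toℕ)
open import Data.Fin.Subset using (Subset; _∈_; _⊆_)
open import Data.Integer as ℤ using (ℤ; +_)
open import Data.List using (List; length)
open import Data.List.Membership.Propositional using () renaming (_∈_ to _∈ˡ_)
open import Data.List.Relation.Unary.Unique.Propositional using (Unique)
open import Data.Nat using (ℕ; suc; _≤_)
open import Data.Product using (_×_; ∃; ∃₂)
open import Function.Bundles using (_⇔_)
open import Relation.Binary.PropositionalEquality using (_≡_)

private
  variable
    n : ℕ

-- Fin n is used as the set [n] = {1, …, n}; its element x stands for the
-- integer suc (toℕ x).
label : Fin n → ℤ
label x = + suc (toℕ x)

_∈[_,_] : ℤ → ℤ → ℤ → Set
m ∈[ i , j ] = i ℤ.≤ m × m ℤ.≤ j

-- Taking i > j shows that the empty set is a segment.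
IsSegment : Subset n → Set
IsSegment {n} U = ∃₂ λ i j →
  (∀ m → m ∈[ i , j ] → m ∈[ + 1 , + n ]) ×
  (∀ x → x ∈ U ⇔ label x ∈[ i , j ])

-- A finite set of subsets, listed without repetition, so that the length of
-- the list is the cardinality of the set.
record Family (n : ℕ) : Set where
  field
    members  : List (Subset n)
    distinct : Unique members

open Family public

infix 4 _∈ᶠ_

_∈ᶠ_ : Subset n → Family n → Set
U ∈ᶠ F = U ∈ˡ members F

card : Family n → ℕ
card F = length (members F)

IsAntichain : Family n → Set
IsAntichain A = ∀ {U V} → U ∈ᶠ A → V ∈ᶠ A → U ⊆ V → U ≡ V

LocallyWide : ℕ → Family n → Set
LocallyWide {n} k F =
  ∀ (x : Fin n) (A : Family n) →
  (∀ {U} → U ∈ᶠ A → U ∈ᶠ F × x ∈ U) →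
  IsAntichain A → card A ≤ k

IsWideSegmentFamily : (k n : ℕ) → Family n → Set
IsWideSegmentFamily k n F = (∀ {U} → U ∈ᶠ F → IsSegment U) × LocallyWide k F

IsMaxCard : (Family n → Set) → ℕ → Set
IsMaxCard P m = (∃ λ F → P F × card F ≡ m) × (∀ F → P F → card F ≤ m)

{-# OPTIONS --safe #-}

-- Write a nonempty segment [i , j] of Fin n as the cell in column i and row j.
-- Antichains of segments through c are the chains, strictly increasing in both
-- coordinates, of cells with columns ≤ c ≤ rows. So the maximum is 1 (for the
-- empty segment) plus the maximum size of a set of cells without such a chain of
-- k + 1 cells, and this is Σ_{j < n} min (j + 1 , 2k), which obeys the recursion.
--
-- Upper bound: if j and j + 1 are among the last k + 1 rows and row j + 1 contains,
-- among the first n ∸ k columns, a column missing from row j, take the largest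
-- such x, delete from row j + 1 its next column after x (x itself if there
-- is none there) and add x to row j. No chain of k + 1 cells arises and the sum of the
-- rows of all cells decreases. Once no move is left, the last k + 1 rows are nested
-- on the first n ∸ k columns, so k + 1 cells of the last row there would give a
-- chain. Hence the last row has at most 2k cells; remove it and induct.
--
-- Lower bound: the cells with i < k or j < i + k. Those through c are split by
-- min (i , j ∸ c) into k classes of comparable segments.
module Submission where

open import Data.Bool using (Bool; true; false; not; if_then_else_; _∧_; _∨_)
import Data.Bool as Bool
open import Data.Bool.Properties using (¬-not; ∨-zeroʳ)
open import Data.Empty using (⊥-elim)
open import Data.Fin using (Fin; toℕ; fromℕ<)
open import Data.Fin.Properties using (toℕ-fromℕ<)
open import Data.Fin.Subset using (Subset; _∈_; _⊆_; ⊥)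
open import Data.Fin.Subset.Properties using (∉⊥; Empty-unique; ⊆-antisym)
import Data.Integer as ℤ
import Data.Integer.Properties as ℤ
open import Data.List using (List; []; _∷_; _++_; map; length; upTo)
open import Data.List.Membership.Propositional using () renaming (_∈_ to _∈ˡ_)
import Data.List.Membership.DecPropositional as DecMembership
open import Data.List.Membership.Propositional.Properties
  using (∈-∃++; ∈-++⁺ˡ; ∈-++⁺ʳ; ∈-++⁻; ∈-map⁺; ∈-map⁻; ∈-upTo⁺)
open import Data.List.Properties using (length-++; length-map; length-upTo)
open import Data.List.Relation.Unary.All as All using ()
open import Data.List.Relation.Unary.AllPairs using ([]; _∷_)
open import Data.List.Relation.Unary.Any using (here; there)
open import Data.List.Relation.Unary.Unique.Propositional using (Unique)
open import Data.List.Relation.Unary.Unique.Propositional.Properties as Unique using ()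
open import Data.Nat
open import Data.Nat.Properties
open import Data.Nat.Tactic.RingSolver using (solve-∀)
open import Data.Product using (_×_; _,_; ∃; ∃₂; proj₁; proj₂; uncurry)
open import Data.Sum using (_⊎_; inj₁; inj₂)
open import Data.Vec using (tabulate)
open import Data.Vec.Properties using (lookup∘tabulate; lookup⇒[]=; []=⇒lookup; ≡-dec)
open import Function using (_∘_; id; const; mk⇔; Equivalence)
open import Level using (0ℓ)
open import Relation.Binary.PropositionalEquality
open import Relation.Nullary using (¬_; Dec; yes; no; does; contradiction)
open import Relation.Nullary.Decidable using (_×-dec_; dec-true; dec-false)
open import Relation.Unary using (Pred; Decidable)
open import Defs

private
  variable
    a b c d i j k m n x y : ℕ
    g h : ℕ → Bool
    f f′ : ℕ → ℕ → Bool

-- Counting cells by rows.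

bit : Bool → ℕ
bit q = if q then 1 else 0

count : ℕ → ℕ → (ℕ → Bool) → ℕ
count a zero    g = 0
count a (suc d) g = bit (g a) + count (suc a) d g

bit≤1 : ∀ q → bit q ≤ 1
bit≤1 true  = ≤-refl
bit≤1 false = z≤n

count-≤ : ∀ a d → count a d g ≤ d
count-≤ a zero = z≤n
count-≤ {g} a (suc d) = +-mono-≤ (bit≤1 (g a)) (count-≤ (suc a) d)

count-+ : ∀ a d e → count a (d + e) g ≡ count a d g + count (a + d) e g
count-+ {g} a zero e = cong (λ s → count s e g) (sym (+-identityʳ a))
count-+ {g} a (suc d) e rewrite count-+ {g} (suc a) d e | +-suc a d =
  sym (+-assoc (bit (g a)) _ _)

count-full : ∀ a d → (∀ i → a ≤ i → i < a + d → g i ≡ true) → count a d g ≡ d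
count-full a zero    all = refl
count-full a (suc d) all rewrite all a ≤-refl (m<m+n a z<s) =
  cong suc (count-full (suc a) d λ i a<i i<a+d →
    all i (<⇒≤ a<i) (subst (i <_) (sym (+-suc a d)) i<a+d))

count-cong : ∀ a d → (∀ i → a ≤ i → g i ≡ h i) → count a d g ≡ count a d h
count-cong a zero    eq = refl
count-cong a (suc d) eq =
  cong₂ _+_ (cong bit (eq a ≤-refl)) (count-cong (suc a) d λ i a<i → eq i (<⇒≤ a<i))

count-new : ∀ a d → (∀ i → i ≢ x → g i ≡ h i) → g x ≡ false → h x ≡ true →
            a ≤ x → x < a + d → count a d h ≡ suc (count a d g)
count-new a zero eq gx hx a≤x x<a+0 =
  contradiction (≤-trans x<a+0 (≤-reflexive (+-identityʳ a))) (≤⇒≯ a≤x)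
count-new {x} {g} {h} a (suc d) eq gx hx a≤x x<a+d with a ≟ x
... | yes refl rewrite gx | hx =
  cong suc (count-cong (suc a) d λ i a<i → sym (eq i (>⇒≢ a<i)))
... | no a≢x rewrite eq a a≢x
                   | count-new {x} {g} {h} (suc a) d eq gx hx (≤∧≢⇒< a≤x a≢x)
                       (subst (x <_) (+-suc a d) x<a+d) =
  +-suc (bit (h a)) _

row : (ℕ → ℕ → Bool) → ℕ → ℕ → Bool
row f j i = f i j

rowCount : (ℕ → ℕ → Bool) → ℕ → ℕ
rowCount f j = count 0 (suc j) (row f j)

-- Only cells of the triangle `i ≤ j < n` are counted. With `const 1` this is their number, with
-- `id` the sum of their rows, the potential that moves decrease; one lemma then tracks both.
weight : (ℕ → ℕ) → ℕ → (ℕ → ℕ → Bool) → ℕ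
weight w zero    f = 0
weight w (suc n) f = w n * rowCount f n + weight w n f

total : ℕ → (ℕ → ℕ → Bool) → ℕ
total = weight (const 1)

weight-cong : ∀ w n → (∀ i j → j < n → f i j ≡ f′ i j) → weight w n f ≡ weight w n f′
weight-cong w zero    eq = refl
weight-cong w (suc n) eq =
  cong₂ _+_ (cong (w n *_) (count-cong 0 (suc n) λ i _ → eq i n ≤-refl))
            (weight-cong w n λ i j j<n → eq i j (m<n⇒m<1+n j<n))

weight-new : ∀ w n → (∀ i j → ¬ (i ≡ x × j ≡ y) → f i j ≡ f′ i j) →
             f x y ≡ false → f′ x y ≡ true → x ≤ y → y < n →
             weight w n f′ ≡ w y + weight w n f
weight-new {x} {y} {f} {f′} w (suc n) eq fx f′x x≤y y<1+n with y ≟ n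
... | yes refl
  rewrite count-new {x} {row f n} {row f′ n} 0 (suc n)
            (λ i i≢x → eq i n (i≢x ∘ proj₁)) fx f′x z≤n (s≤s x≤y)
        | weight-cong {f′} {f} w n (λ i j j<n → sym (eq i j (<⇒≢ j<n ∘ proj₂)))
        | *-suc (w n) (rowCount f n) = +-assoc (w n) _ _
... | no y≢n
  rewrite count-cong {row f′ n} {row f n} 0 (suc n) (λ i _ → sym (eq i n (y≢n ∘ sym ∘ proj₂)))
        | weight-new {x} {y} {f} {f′} w n eq fx f′x x≤y (≤∧≢⇒< (≤-pred y<1+n) y≢n) =
  lemma (w n * rowCount f n) (w y) _
  where
  lemma : ∀ p q r → p + (q + r) ≡ q + (p + r)
  lemma = solve-∀

-- Moving a cell one row down.

cell? : ∀ x y i j → Dec (i ≡ x × j ≡ y)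
cell? x y i j = i ≟ x ×-dec j ≟ y

insert erase : ℕ → ℕ → (ℕ → ℕ → Bool) → ℕ → ℕ → Bool
insert x y f i j = does (cell? x y i j) ∨ f i j
erase  x y f i j = not (does (cell? x y i j)) ∧ f i j

insert-hit : ∀ x y → insert x y f x y ≡ true
insert-hit x y rewrite dec-true (cell? x y x y) (refl , refl) = refl

erase-hit : ∀ x y → erase x y f x y ≡ false
erase-hit x y rewrite dec-true (cell? x y x y) (refl , refl) = refl

insert-miss : ∀ x y i j → ¬ (i ≡ x × j ≡ y) → f i j ≡ insert x y f i j
insert-miss x y i j ≢ rewrite dec-false (cell? x y i j) ≢ = refl

erase-miss : ∀ x y i j → ¬ (i ≡ x × j ≡ y) → erase x y f i j ≡ f i j
erase-miss x y i j ≢ rewrite dec-false (cell? x y i j) ≢ = refl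

move : ℕ → ℕ → ℕ → (ℕ → ℕ → Bool) → ℕ → ℕ → Bool
move x y j f = insert x j (erase y (suc j) f)

-- Erasing removes `w (suc j)` and inserting adds `w j`, written without subtraction. The bounds on
-- `x` and `y` keep both cells inside the triangle that `weight` sees.
weight-move : ∀ w n → f x j ≡ false → f y (suc j) ≡ true → x ≤ j → y ≤ suc j → suc j < n →
              weight w n f + w j ≡ weight w n (move x y j f) + w (suc j)
weight-move {f} {x} {j} {y} w n fx fy x≤j y≤1+j 1+j<n = begin
  weight w n f + w j                   ≡⟨ cong (_+ w j) erased ⟩
  w (suc j) + weight w n e + w j       ≡⟨ lemma (w (suc j)) _ (w j) ⟩
  (w j + weight w n e) + w (suc j)     ≡⟨ cong (_+ w (suc j)) inserted ⟨
  weight w n (move x y j f) + w (suc j) ∎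
  where
  open ≡-Reasoning
  e = erase y (suc j) f
  ex : e x j ≡ false
  ex = trans (erase-miss {f} y (suc j) x j (<⇒≢ (n<1+n j) ∘ proj₂)) fx
  erased : weight w n f ≡ w (suc j) + weight w n e
  erased = weight-new w n (erase-miss y (suc j)) (erase-hit {f} y (suc j)) fy y≤1+j 1+j<n
  inserted : weight w n (move x y j f) ≡ w j + weight w n e
  inserted = weight-new w n (insert-miss x j) ex (insert-hit {e} x j) x≤j (<⇒≤ 1+j<n)
  lemma : ∀ p q r → p + q + r ≡ (r + q) + p
  lemma = solve-∀

move-inv : ∀ x y j a b → move x y j f a b ≡ true →
           (a ≡ x × b ≡ j) ⊎ (f a b ≡ true × ¬ (a ≡ y × b ≡ suc j))
move-inv {f} x y j a b eq with cell? x j a b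
... | yes hit = inj₁ hit
... | no miss = inj₂ (split (trans (insert-miss {e} x j a b miss) eq))
  where
  e = erase y (suc j) f
  split : e a b ≡ true → f a b ≡ true × ¬ (a ≡ y × b ≡ suc j)
  split eab with cell? y (suc j) a b
  ... | yes (refl , refl) = contradiction (trans (sym eab) (erase-hit {f} a b)) λ ()
  ... | no miss′ = trans (sym (erase-miss {f} y (suc j) a b miss′)) eab , miss′

-- Chains of cells.

data Chain (n : ℕ) (f : ℕ → ℕ → Bool) (c : ℕ) : ℕ → ℕ → ℕ → Set where
  []   : Chain n f c i j 0
  cons : i ≤ x → x ≤ c → j ≤ y → y < n → f x y ≡ true →
         Chain n f c (suc x) (suc y) m → Chain n f c i j (suc m)

-- For j ≥ c the segments [i, j] with i ≤ c are those through c, so these are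
-- the antichains of suc k segments through c.
NoChain : ℕ → ℕ → (ℕ → ℕ → Bool) → Set
NoChain k n f = ∀ c → ¬ Chain n f c 0 c (suc k)

chain-columns : i ≤ suc c → Chain n f c i j m → i + m ≤ suc c
chain-columns {i} i≤1+c [] = ≤-trans (≤-reflexive (+-identityʳ i)) i≤1+c
chain-columns {i} _ (cons {x = x} {m = m} i≤x x≤c _ _ _ ch) =
  ≤-trans (≤-reflexive (+-suc i m))
    (≤-trans (s≤s (+-monoˡ-≤ m i≤x)) (chain-columns (s≤s x≤c) ch))

chain-rows : n ≤ d → Chain n f c i j m → Chain d f c i j m
chain-rows n≤d [] = []
chain-rows n≤d (cons i≤x x≤c j≤y y<n fxy ch) =
  cons i≤x x≤c j≤y (≤-trans y<n n≤d) fxy (chain-rows n≤d ch)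

-- Moves create no long chain.

module _ {n k j x y : ℕ} {f : ℕ → ℕ → Bool}
  (1+j<n : suc j < n) (fx : f x (suc j) ≡ true)
  (next : ∀ z → x < z → z + k < n → f z (suc j) ≡ true → z ≢ y →
          x < y × y < z × f y j ≡ true) where

  -- Only the inserted cell `(x , j)` can be foreign to `f`. It is replaced by `(x , suc j)` if the
  -- chain ends there or skips row `suc j`, and otherwise by `(y , j)`, which `next` places in `f`
  -- strictly left of the following cell. The bound `len` holds for a chain of `suc k` cells from
  -- row `c` and survives passing to tails; it forces a following cell in row `suc j` into the
  -- columns where `next` applies.
  chain-unmove : ∀ {i l} → c + suc k ≤ l + m →
                 Chain n (move x y j f) c i l m → Chain n f c i l m
  chain-unmove len [] = []
  chain-unmove {c} {suc m} {i} {l} len (cons {x = a} {y = b} i≤a a≤c l≤b b<n ab ch)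
    with move-inv {f} x y j a b ab
  ... | inj₂ (fab , _) = cons i≤a a≤c l≤b b<n fab (chain-unmove
          (≤-trans len (≤-trans (≤-reflexive (+-suc l m)) (s≤s (+-monoˡ-≤ m l≤b)))) ch)
  ... | inj₁ (refl , refl) with ch
  ...   | [] = cons i≤a a≤c (m≤n⇒m≤1+n l≤b) 1+j<n fx []
  ...   | cons {x = a₂} {y = b₂} {m = m₂} a<a₂ a₂≤c b<b₂ b₂<n ab₂ ch₂ =
          after (move-inv {f} x y j a₂ b₂ ab₂) (b₂ ≟ suc j) (a₂ + k <? n)
    where
    open ≤-Reasoning

    len₂ : c + suc k ≤ suc (suc j) + m₂
    len₂ = begin
      c + suc k         ≤⟨ len ⟩
      l + suc (suc m₂)  ≤⟨ +-monoˡ-≤ _ l≤b ⟩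
      j + suc (suc m₂)  ≡⟨ +-suc j (suc m₂) ⟩
      suc (j + suc m₂)  ≡⟨ cong suc (+-suc j m₂) ⟩
      suc (suc j) + m₂  ∎

    ch₂′ : Chain n f c (suc a₂) (suc b₂) m₂
    ch₂′ = chain-unmove (≤-trans len₂ (+-monoˡ-≤ m₂ (s≤s b<b₂))) ch₂

    after : (a₂ ≡ x × b₂ ≡ j) ⊎ (f a₂ b₂ ≡ true × ¬ (a₂ ≡ y × b₂ ≡ suc j)) →
            Dec (b₂ ≡ suc j) → Dec (a₂ + k < n) → Chain n f c i l (suc (suc m₂))
    after (inj₁ (_ , refl)) _ _ = contradiction b<b₂ (<-irrefl refl)
    after (inj₂ (fab₂ , _)) (no b₂≢1+j) _ =
      cons i≤a a≤c (m≤n⇒m≤1+n l≤b) 1+j<n fx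
        (cons a<a₂ a₂≤c (≤∧≢⇒< b<b₂ (b₂≢1+j ∘ sym)) b₂<n fab₂ ch₂′)
    after (inj₂ (fab₂ , ≢y)) (yes refl) (yes a₂+k<n)
      with next a₂ a<a₂ a₂+k<n fab₂ (λ e → ≢y (e , refl))
    ... | x<y , y<a₂ , fy =
      cons (≤-trans i≤a (<⇒≤ x<y)) (≤-trans (<⇒≤ y<a₂) a₂≤c) l≤b b<n fy
        (cons y<a₂ a₂≤c b<b₂ b₂<n fab₂ ch₂′)
    -- The rows above suc j are too few for the chain to end at a column ≤ c.
    after (inj₂ _) (yes refl) (no a₂+k≮n) = contradiction (begin-strict
      c + k              <⟨ n<1+n _ ⟩
      suc (c + k)        ≡⟨ +-suc c k ⟨
      c + suc k          ≤⟨ len₂ ⟩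
      suc (suc j) + m₂   ≤⟨ +-monoˡ-≤ m₂ 1+j<n ⟩
      n + m₂             ≤⟨ +-monoˡ-≤ m₂ (≮⇒≥ a₂+k≮n) ⟩
      a₂ + k + m₂        ≡⟨ +-assoc a₂ k m₂ ⟩
      a₂ + (k + m₂)      ≡⟨ cong (a₂ +_) (+-comm k m₂) ⟩
      a₂ + (m₂ + k)      ≡⟨ +-assoc a₂ m₂ k ⟨
      a₂ + m₂ + k        ≤⟨ +-monoˡ-≤ k (≤-pred (chain-columns (s≤s a₂≤c) ch₂)) ⟩
      c + k              ∎) (<-irrefl refl)

  noChain-move : NoChain k n f → NoChain k n (move x y j f)
  noChain-move none c ch = none c (chain-unmove ≤-refl ch)

-- Finding a move.

-- source is the successor of target in C, or target itself when target is the
-- last element of C.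
record Movable (C A : Pred ℕ 0ℓ) : Set where
  constructor movable
  field
    target source : ℕ
    target≤source : target ≤ source
    C-target      : C target
    C-source      : C source
    ¬A-target     : ¬ A target
    next : ∀ z → target < z → C z → z ≢ source → target < source × source < z × A source

module _ {C A : Pred ℕ 0ℓ} (C? : Decidable C) (A? : Decidable A) where

  private
    FirstFrom : ℕ → Set
    FirstFrom i = (∀ z → i ≤ z → ¬ C z) ⊎ (∃ λ y → i ≤ y × C y × (∀ z → i ≤ z → C z → y ≤ z))

    -- A scan from the right: `C` from `i` on already lies in `A`, and `FirstFrom` remembers the
    -- least element of `C` there. So the first failure is the largest element of `C` outside `A`,
    -- and the remembered element is its successor in `C`, which lies in `A`.
    descend : ∀ i → (∀ z → i ≤ z → C z → A z) → FirstFrom i → Movable C A ⊎ (∀ z → C z → A z)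
    descend zero    C⊆A first = inj₂ (λ z → C⊆A z z≤n)
    descend (suc i) C⊆A first with C? i
    ... | no ¬Ci = descend i (λ z i≤z Cz → C⊆A z (above z i≤z Cz) Cz) (first′ first)
      where
      above : ∀ z → i ≤ z → C z → i < z
      above z i≤z Cz = ≤∧≢⇒< i≤z λ { refl → ¬Ci Cz }
      first′ : FirstFrom (suc i) → FirstFrom i
      first′ (inj₁ none) = inj₁ λ z i≤z Cz → none z (above z i≤z Cz) Cz
      first′ (inj₂ (y , i<y , Cy , least)) =
        inj₂ (y , <⇒≤ i<y , Cy , λ z i≤z Cz → least z (above z i≤z Cz) Cz)
    ... | yes Ci with A? i
    ...   | yes Ai = descend i C⊆A′ (inj₂ (i , ≤-refl , Ci , λ z i≤z _ → i≤z))
      where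
      C⊆A′ : ∀ z → i ≤ z → C z → A z
      C⊆A′ z i≤z Cz with i ≟ z
      ... | yes refl = Ai
      ... | no  i≢z  = C⊆A z (≤∧≢⇒< i≤z i≢z) Cz
    ...   | no ¬Ai with first
    ...     | inj₁ none = inj₁ (movable i i ≤-refl Ci Ci ¬Ai
                λ z i<z Cz _ → contradiction Cz (none z i<z))
    ...     | inj₂ (y , i<y , Cy , least) = inj₁ (movable i y (<⇒≤ i<y) Ci Cy ¬Ai
                λ z i<z Cz z≢y → i<y , ≤∧≢⇒< (least z i<z Cz) (z≢y ∘ sym) , C⊆A y i<y Cy)

  movable⊎⊆ : (∀ z → C z → z < n) → Movable C A ⊎ (∀ z → C z → A z)
  movable⊎⊆ {n} C<n = descend n
    (λ z n≤z Cz → contradiction (C<n z Cz) (≤⇒≯ n≤z))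
    (inj₁ λ z n≤z Cz → contradiction (C<n z Cz) (≤⇒≯ n≤z))

search : ∀ {P Q : Pred ℕ 0ℓ} → (∀ j → P j ⊎ Q j) → ∀ m → (∃ λ j → j < m × P j) ⊎ (∀ j → j < m → Q j)
search P⊎Q zero = inj₂ λ _ ()
search P⊎Q (suc m) with P⊎Q m | search P⊎Q m
... | inj₁ p | _ = inj₁ (m , ≤-refl , p)
... | inj₂ _ | inj₁ (j , j<m , p) = inj₁ (j , m<n⇒m<1+n j<m , p)
... | inj₂ q | inj₂ qs = inj₂ λ j j<1+m → case′ j (m≤n⇒m<n∨m≡n (≤-pred j<1+m))
  where
  case′ : ∀ j → j < m ⊎ j ≡ m → _
  case′ j (inj₁ j<m)  = qs j j<m
  case′ j (inj₂ refl) = q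

-- Upper bound on the number of cells.

wideBound : ℕ → ℕ → ℕ
wideBound k zero    = 0
wideBound k (suc n) = (suc n ⊓ (k + k)) + wideBound k n

Cut : ℕ → ℕ → (ℕ → ℕ → Bool) → ℕ → Pred ℕ 0ℓ
Cut k n f j z = z + k < n × f z j ≡ true

NestedRows : ℕ → ℕ → (ℕ → ℕ → Bool) → Set
NestedRows k n f = ∀ j → suc j < n → n ≤ j + suc k → ∀ z → Cut k n f (suc j) z → f z j ≡ true

nested-down : NestedRows k (suc n) f → x + k < suc n → f x n ≡ true →
              ∀ m j → m ≤ k → j + m ≡ n → f x j ≡ true
nested-down {n = n} {f} {x} nested x+k<n fx zero j _ j+0≡n =
  subst (λ r → f x r ≡ true) (trans (sym j+0≡n) (+-identityʳ j)) fx
nested-down {k} nested x+k<n fx (suc m) j m<k refl =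
  nested j (s≤s (m<m+n j z<s)) (≤-trans (≤-reflexive (sym (+-suc j (suc m)))) (+-monoʳ-≤ j (s≤s m<k)))
    _ (x+k<n , nested-down nested x+k<n fx m (suc j) (<⇒≤ m<k) (sym (+-suc j m)))

-- By nesting, a column `≤ c` occupied in the last row `n` is occupied in each of the last `suc k`
-- rows. So the first `m` such columns from `a` on can be laid out diagonally, one per row from `j`
-- to `n`.
nested-chain : NestedRows k (suc n) f → c + k ≡ n →
               ∀ a d m j → m ≤ suc k → m ≤ count a d (row f n) → a + d ≤ suc c → j + m ≡ suc n →
               Chain (suc n) f c a j m
nested-chain nested c+k≡n a d zero j m≤1+k m≤count a+d≤1+c j+m≡1+n = []
nested-chain {k} {n} {f} {c} nested c+k≡n a (suc d) (suc m) j m<1+k m<count a+d<1+c j+m≡1+n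
  with f a n in fan
... | false = lower (nested-chain nested c+k≡n (suc a) d (suc m) j m<1+k m<count
                (≤-trans (≤-reflexive (sym (+-suc a d))) a+d<1+c) j+m≡1+n)
  where
  lower : Chain (suc n) f c (suc a) j (suc m) → Chain (suc n) f c a j (suc m)
  lower (cons a<x x≤c j≤y y<n fxy ch) = cons (<⇒≤ a<x) x≤c j≤y y<n fxy ch
... | true = cons ≤-refl a≤c ≤-refl (≤-trans (m<m+n j z<s) (≤-reflexive j+m≡1+n))
               (nested-down nested (s≤s (≤-trans (+-monoˡ-≤ k a≤c) (≤-reflexive c+k≡n))) fan
                  m j (≤-pred m<1+k) j+m≡n)
               (nested-chain nested c+k≡n (suc a) d m (suc j) (<⇒≤ m<1+k) (≤-pred m<count)
                  (≤-trans (≤-reflexive (sym (+-suc a d))) a+d<1+c) (cong suc j+m≡n))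
  where
  j+m≡n : j + m ≡ n
  j+m≡n = suc-injective (trans (sym (+-suc j m)) j+m≡1+n)
  a≤c : a ≤ c
  a≤c = ≤-trans (m≤m+n a d) (≤-pred (≤-trans (≤-reflexive (sym (+-suc a d))) a+d<1+c))

-- The last `k` columns hold at most `k` cells. More than `k` cells among the other `suc (n ∸ k)`
-- columns would give a forbidden chain at the point `n ∸ k`, in the rows from `n ∸ k` to `n`.
nested-rowCount : NoChain k (suc n) f → NestedRows k (suc n) f → k ≤ n → rowCount f n ≤ k + k
nested-rowCount {k} {n} {f} none nested k≤n = begin
  count 0 (suc n) (row f n)                                    ≡⟨ cong (λ r → count 0 (suc r) (row f n)) (m∸n+n≡m k≤n) ⟨
  count 0 (suc last + k) (row f n)                             ≡⟨ count-+ 0 (suc last) k ⟩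
  count 0 (suc last) (row f n) + count (suc last) k (row f n)  ≤⟨ +-mono-≤ few (count-≤ (suc last) k) ⟩
  k + k                                                        ∎
  where
  open ≤-Reasoning
  last = n ∸ k
  few : count 0 (suc last) (row f n) ≤ k
  few = ≮⇒≥ λ many → none last (nested-chain nested (m∸n+n≡m k≤n) 0 (suc last) (suc k) last
    ≤-refl many ≤-refl (trans (+-suc last k) (cong suc (m∸n+n≡m k≤n))))

lower-or-nested : NoChain k n f → NestedRows k n f ⊎
  ∃ λ f′ → NoChain k n f′ × total n f ≡ total n f′ × weight id n f ≡ suc (weight id n f′)
lower-or-nested {k} {n} {f} none with search rows n
  where
  rows : ∀ j → ((suc j < n × n ≤ j + suc k) × Movable (Cut k n f (suc j)) (λ z → f z j ≡ true))
             ⊎ (suc j < n → n ≤ j + suc k → ∀ z → Cut k n f (suc j) z → f z j ≡ true)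
  rows j with suc j <? n ×-dec n ≤? j + suc k
  ... | no  outside = inj₂ λ 1+j<n j-high → contradiction (1+j<n , j-high) outside
  ... | yes inside with movable⊎⊆ {C = Cut k n f (suc j)}
                         (λ z → z + k <? n ×-dec f z (suc j) Bool.≟ true) (λ z → f z j Bool.≟ true)
                         (λ z Cz → ≤-trans (s≤s (m≤m+n z k)) (proj₁ Cz))
  ...   | inj₁ mov = inj₁ (inside , mov)
  ...   | inj₂ C⊆A = inj₂ λ _ _ → C⊆A
... | inj₂ nested = inj₁ λ j 1+j<n → nested j (<-trans (n<1+n j) 1+j<n) 1+j<n
... | inj₁ (j , _ , (1+j<n , j-high) , movable x y x≤y (x+k<n , fx) (y+k<n , fy) ¬fx next) =
  inj₂ (move x y j f
       , noChain-move 1+j<n fx (λ z x<z z+k<n fz → next z x<z (z+k<n , fz)) none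
       , +-cancelʳ-≡ 1 _ _ (weight-moved (const 1))
       , +-cancelʳ-≡ j _ _ (trans (weight-moved id) (+-suc _ j)))
  where
  -- Here `z < n ∸ k ≤ suc j`, so the target of the move is a genuine cell of row `j`.
  ≤j : ∀ {z} → z + k < n → z ≤ j
  ≤j {z} z+k<n = +-cancelʳ-≤ k z j (≤-pred (≤-trans z+k<n (≤-trans j-high (≤-reflexive (+-suc j k)))))

  weight-moved : ∀ w → weight w n f + w j ≡ weight w n (move x y j f) + w (suc j)
  weight-moved w = weight-move w n (¬-not ¬fx) fy (≤j x+k<n) (m≤n⇒m≤1+n (≤j y+k<n)) 1+j<n

-- Induction on the row sum `s`, which every move lowers by exactly one.
nested-form : ∀ s f → weight id n f ≡ s → NoChain k n f →
              ∃ λ f′ → NoChain k n f′ × total n f ≡ total n f′ × NestedRows k n f′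
nested-form s f weight≡s none with lower-or-nested none
... | inj₁ nested = f , none , refl , nested
nested-form zero f weight≡0 none | inj₂ (_ , _ , _ , drop) with () ← trans (sym drop) weight≡0
nested-form (suc s) f weight≡s none | inj₂ (f₁ , none₁ , total₁ , drop)
  with f₂ , none₂ , total₂ , nested ← nested-form s f₁ (suc-injective (trans (sym drop) weight≡s)) none₁
  = f₂ , none₂ , trans total₁ total₂ , nested

total≤wideBound : ∀ k n f → NoChain k n f → total n f ≤ wideBound k n
total≤wideBound k zero    f none = z≤n
total≤wideBound k (suc n) f none
  with f′ , none′ , total≡ , nested ← nested-form _ f refl none = begin
  total (suc n) f                    ≡⟨ total≡ ⟩
  1 * rowCount f′ n + total n f′     ≤⟨ +-mono-≤ top rest ⟩
  (suc n ⊓ (k + k)) + wideBound k n  ∎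
  where
  open ≤-Reasoning
  top : 1 * rowCount f′ n ≤ suc n ⊓ (k + k)
  top = ≤-trans (≤-reflexive (*-identityˡ _)) (⊓-glb (count-≤ 0 (suc n)) short)
    where
    short : rowCount f′ n ≤ k + k
    short with k ≤? n
    ... | yes k≤n = nested-rowCount none′ nested k≤n
    -- For `k > n` the whole row has only `suc n ≤ k` columns.
    ... | no  k≰n = ≤-trans (count-≤ 0 (suc n)) (≤-trans (≰⇒> k≰n) (m≤m+n k k))
  rest : total n f′ ≤ wideBound k n
  rest = total≤wideBound k n f′ λ c ch → none′ c (chain-rows (n≤1+n n) ch)

-- Comparing and mapping lists without repetition.

-- Induction on `xs`: the partner of the head is cut out of `ys`, and by `inj` no later element is
-- related to it. A relation replaces a function because a colour will be tied to a subset only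
-- through some pair of end points.
pigeonhole : ∀ {A B : Set} {R : A → B → Set} {xs : List A} {ys : List B} → Unique xs →
             (∀ {x} → x ∈ˡ xs → ∃ λ y → y ∈ˡ ys × R x y) →
             (∀ {x x′ y} → x ∈ˡ xs → x′ ∈ˡ xs → R x y → R x′ y → x ≡ x′) →
             length xs ≤ length ys
pigeonhole [] hit inj = z≤n
pigeonhole {A} {B} {R} {x ∷ xs} (x∉xs ∷ distinct) hit inj
  with y , y∈ys , Rxy ← hit (here refl) with as , bs , refl ← ∈-∃++ y∈ys = begin
  suc (length xs)                ≤⟨ s≤s (pigeonhole distinct hit′ (λ u v → inj (there u) (there v))) ⟩
  suc (length (as ++ bs))        ≡⟨ cong suc (length-++ as) ⟩
  suc (length as + length bs)    ≡⟨ +-suc (length as) (length bs) ⟨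
  length as + suc (length bs)    ≡⟨ length-++ as ⟨
  length (as ++ y ∷ bs)          ∎
  where
  open ≤-Reasoning
  hit′ : ∀ {x′} → x′ ∈ˡ xs → ∃ λ y′ → y′ ∈ˡ (as ++ bs) × R x′ y′
  hit′ x′∈xs with y′ , y′∈ys , Rx′y′ ← hit (there x′∈xs) with ∈-++⁻ as y′∈ys
  ... | inj₁ y′∈as         = y′ , ∈-++⁺ˡ y′∈as , Rx′y′
  ... | inj₂ (there y′∈bs) = y′ , ∈-++⁺ʳ as y′∈bs , Rx′y′
  ... | inj₂ (here refl)   = contradiction (inj (here refl) (there x′∈xs) Rxy Rx′y′)
                                           (All.lookup x∉xs x′∈xs)

-- Injectivity is asked on the list only, since `seg` sends every pair with `i > j` to the empty
-- set.
map-unique : ∀ {A B : Set} {φ : A → B} {xs : List A} →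
             (∀ {x y} → x ∈ˡ xs → y ∈ˡ xs → φ x ≡ φ y → x ≡ y) → Unique xs → Unique (map φ xs)
map-unique inj [] = []
map-unique {φ = φ} {x ∷ xs} inj (x∉xs ∷ distinct) =
  All.tabulate (λ φy∈ → fresh (∈-map⁻ φ φy∈)) ∷ map-unique (λ u v → inj (there u) (there v)) distinct
  where
  fresh : ∀ {q} → (∃ λ y → y ∈ˡ xs × q ≡ φ y) → φ x ≢ q
  fresh (y , y∈xs , refl) φx≡φy = All.lookup x∉xs y∈xs (inj (here refl) (there y∈xs) φx≡φy)

-- Segments as subsets.

does⁻ : ∀ {P : Set} (P? : Dec P) → does P? ≡ true → P
does⁻ (yes p) _ = p

opaque
  -- End points are counted from zero: these are the points with labels from `suc i` to `suc j`.
  -- Sealing the definition leaves the two membership lemmas as its interface.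
  seg : ℕ → ℕ → Subset n
  seg i j = tabulate λ x → does (i ≤? toℕ x ×-dec toℕ x ≤? j)

  ∈-seg⁺ : {x : Fin n} → i ≤ toℕ x → toℕ x ≤ j → x ∈ seg i j
  ∈-seg⁺ {i = i} {j} {x} i≤x x≤j = lookup⇒[]= x _
    (trans (lookup∘tabulate _ x) (dec-true (i ≤? toℕ x ×-dec toℕ x ≤? j) (i≤x , x≤j)))

  ∈-seg⁻ : {x : Fin n} → x ∈ seg i j → i ≤ toℕ x × toℕ x ≤ j
  ∈-seg⁻ {i = i} {j} {x} x∈ = does⁻ (i ≤? toℕ x ×-dec toℕ x ≤? j)
    (trans (sym (lookup∘tabulate _ x)) ([]=⇒lookup x∈))

seg-⊆ : x ≤ i → j ≤ y → seg {n} i j ⊆ seg x y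
seg-⊆ x≤i j≤y u∈ with i≤u , u≤j ← ∈-seg⁻ u∈ = ∈-seg⁺ (≤-trans x≤i i≤u) (≤-trans u≤j j≤y)

-- Test the inclusion at the two end points, which lie in `seg i j` because `i ≤ j < n`.
seg-⊆⁻ : i ≤ j → j < n → seg {n} i j ⊆ seg x y → x ≤ i × j ≤ y
seg-⊆⁻ {i} {j} {n} {x} {y} i≤j j<n sub =
  subst (x ≤_) toℕi (proj₁ (∈-seg⁻ (sub (∈-seg⁺
    (≤-reflexive (sym toℕi)) (≤-trans (≤-reflexive toℕi) i≤j))))) ,
  subst (_≤ y) toℕj (proj₂ (∈-seg⁻ (sub (∈-seg⁺
    (≤-trans i≤j (≤-reflexive (sym toℕj))) (≤-reflexive toℕj)))))
  where
  toℕi = toℕ-fromℕ< (≤-<-trans i≤j j<n)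
  toℕj = toℕ-fromℕ< j<n

seg-injective : i ≤ j → j < n → x ≤ y → y < n → seg {n} i j ≡ seg x y → i ≡ x × j ≡ y
seg-injective i≤j j<n x≤y y<n eq
  with x≤i , j≤y ← seg-⊆⁻ i≤j j<n (subst (_ ∈_) eq)
     | i≤x , y≤j ← seg-⊆⁻ x≤y y<n (subst (_ ∈_) (sym eq)) = ≤-antisym i≤x x≤i , ≤-antisym j≤y y≤j

⊥-isSegment : IsSegment (⊥ {n})
⊥-isSegment = ℤ.+ 1 , ℤ.+ 0 , (λ m (1≤m , m≤0) → contradiction (ℤ.≤-trans 1≤m m≤0) λ { (ℤ.+≤+ ()) })
  , λ x → mk⇔ (λ x∈⊥ → contradiction x∈⊥ ∉⊥)
              (λ (1≤x , x≤0) → contradiction (ℤ.≤-trans 1≤x x≤0) λ { (ℤ.+≤+ ()) })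

seg-isSegment : j < n → IsSegment (seg {n} i j)
seg-isSegment {j} {n} {i} j<n = ℤ.+ suc i , ℤ.+ suc j
  , (λ m (i≤m , m≤j) → ℤ.≤-trans (ℤ.+≤+ (s≤s z≤n)) i≤m , ℤ.≤-trans m≤j (ℤ.+≤+ j<n))
  , λ x → mk⇔ (λ x∈ → ℤ.+≤+ (s≤s (proj₁ (∈-seg⁻ x∈))) , ℤ.+≤+ (s≤s (proj₂ (∈-seg⁻ x∈))))
              λ { (ℤ.+≤+ i<x , ℤ.+≤+ x<j) → ∈-seg⁺ (≤-pred i<x) (≤-pred x<j) }

-- If `p ≤ q`, both belong to the integer interval, so `within` puts them between 1 and `n`, and
-- subtracting one gives natural end points.
segment-form : {U : Subset n} → IsSegment U → U ≡ ⊥ ⊎ ∃₂ λ i j → i ≤ j × j < n × U ≡ seg i j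
segment-form {n} {U} (p , q , within , U⇔) with p ℤ.≤? q
... | no p≰q = inj₁ (Empty-unique λ (x , x∈U) →
        p≰q (uncurry ℤ.≤-trans (Equivalence.to (U⇔ x) x∈U)))
... | yes p≤q with within p (ℤ.≤-refl , p≤q) | within q (p≤q , ℤ.≤-refl)
segment-form {n} {U} (ℤ.+ suc i , ℤ.+ suc j , within , U⇔)
  | yes (ℤ.+≤+ i≤j) | ℤ.+≤+ (s≤s _) , _ | _ , ℤ.+≤+ j<n =
  inj₂ (i , j , ≤-pred i≤j , j<n , ⊆-antisym
    (λ {x} x∈U → from-ℤ (Equivalence.to (U⇔ x) x∈U))
    (λ {x} x∈ → Equivalence.from (U⇔ x)
      (ℤ.+≤+ (s≤s (proj₁ (∈-seg⁻ x∈))) , ℤ.+≤+ (s≤s (proj₂ (∈-seg⁻ x∈))))))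
  where
  from-ℤ : {x : Fin n} → label x ∈[ ℤ.+ suc i , ℤ.+ suc j ] → x ∈ seg i j
  from-ℤ (ℤ.+≤+ i<x , ℤ.+≤+ x<j) = ∈-seg⁺ (≤-pred i<x) (≤-pred x<j)

-- Families built from cells.

select : ℕ → ℕ → (ℕ → Bool) → List ℕ
select a zero    g = []
select a (suc d) g = if g a then a ∷ select (suc a) d g else select (suc a) d g

length-select : ∀ a d → length (select a d g) ≡ count a d g
length-select a zero = refl
length-select {g} a (suc d) with g a
... | true  = cong suc (length-select (suc a) d)
... | false = length-select (suc a) d

∈-select⁻ : ∀ a d → i ∈ˡ select a d g → a ≤ i × i < a + d × g i ≡ true
∈-select⁻ {g = g} a (suc d) i∈ with g a in ga
∈-select⁻ a (suc d) (here refl) | true = ≤-refl , m<m+n a z<s , ga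
∈-select⁻ {i} a (suc d) (there i∈) | true with a<i , i<a+d , gi ← ∈-select⁻ (suc a) d i∈ =
  <⇒≤ a<i , subst (i <_) (sym (+-suc a d)) i<a+d , gi
∈-select⁻ {i} a (suc d) i∈ | false with a<i , i<a+d , gi ← ∈-select⁻ (suc a) d i∈ =
  <⇒≤ a<i , subst (i <_) (sym (+-suc a d)) i<a+d , gi

∈-select⁺ : ∀ a d → a ≤ i → i < a + d → g i ≡ true → i ∈ˡ select a d g
∈-select⁺ {i} a zero a≤i i<a+0 gi =
  contradiction (≤-trans i<a+0 (≤-reflexive (+-identityʳ a))) (≤⇒≯ a≤i)
∈-select⁺ {i} {g} a (suc d) a≤i i<a+d gi with a ≟ i
... | yes refl rewrite gi = here refl
... | no a≢i with g a
...   | true  = there (∈-select⁺ (suc a) d (≤∧≢⇒< a≤i a≢i) (subst (i <_) (+-suc a d) i<a+d) gi)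
...   | false = ∈-select⁺ (suc a) d (≤∧≢⇒< a≤i a≢i) (subst (i <_) (+-suc a d) i<a+d) gi

select-unique : ∀ a d → Unique (select a d g)
select-unique a zero = []
select-unique {g} a (suc d) with g a
... | true  = All.tabulate (λ i∈ → <⇒≢ (proj₁ (∈-select⁻ {g = g} (suc a) d i∈))) ∷ select-unique (suc a) d
... | false = select-unique (suc a) d

cells : ℕ → (ℕ → ℕ → Bool) → List (ℕ × ℕ)
cells zero    f = []
cells (suc n) f = map (_, n) (select 0 (suc n) (row f n)) ++ cells n f

length-cells : ∀ n f → length (cells n f) ≡ total n f
length-cells zero    f = refl
length-cells (suc n) f = begin
  length (map (_, n) s ++ cells n f)         ≡⟨ length-++ (map (_, n) s) ⟩
  length (map (_, n) s) + length (cells n f) ≡⟨ cong₂ _+_ length-row (length-cells n f) ⟩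
  rowCount f n + total n f                   ≡⟨ cong (_+ total n f) (*-identityˡ (rowCount f n)) ⟨
  1 * rowCount f n + total n f               ∎
  where
  open ≡-Reasoning
  s = select 0 (suc n) (row f n)
  length-row : length (map (_, n) s) ≡ rowCount f n
  length-row = trans (length-map (_, n) s) (length-select 0 (suc n))

∈-cells⁻ : ∀ n → (i , j) ∈ˡ cells n f → i ≤ j × j < n × f i j ≡ true
∈-cells⁻ {f = f} (suc n) ij∈ with ∈-++⁻ (map (_, n) (select 0 (suc n) (row f n))) ij∈
... | inj₂ ij∈cells with i≤j , j<n , fij ← ∈-cells⁻ n ij∈cells = i≤j , m<n⇒m<1+n j<n , fij
... | inj₁ ij∈row with _ , i∈ , refl ← ∈-map⁻ (_, n) ij∈row
                  with _ , s≤s i≤n , fin ← ∈-select⁻ {g = row f n} 0 (suc n) i∈ = i≤n , ≤-refl , fin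

∈-cells⁺ : ∀ n → i ≤ j → j < n → f i j ≡ true → (i , j) ∈ˡ cells n f
∈-cells⁺ {i} {j} {f} (suc n) i≤j j<1+n fij with j ≟ n
... | yes refl = ∈-++⁺ˡ (∈-map⁺ (_, n) (∈-select⁺ {g = row f n} 0 (suc n) z≤n (s≤s i≤j) fij))
... | no j≢n   = ∈-++⁺ʳ _ (∈-cells⁺ n i≤j (≤∧≢⇒< (≤-pred j<1+n) j≢n) fij)

cells-unique : ∀ n f → Unique (cells n f)
cells-unique zero    f = []
cells-unique (suc n) f = Unique.++⁺
  (Unique.map⁺ (cong proj₁) (select-unique 0 (suc n))) (cells-unique n f)
  λ { (ij∈row , ij∈cells) → disjoint (∈-map⁻ (_, n) ij∈row) ij∈cells }
  where
  disjoint : ∀ {p} {xs : List ℕ} → (∃ λ i → i ∈ˡ xs × p ≡ (i , n)) → ¬ (p ∈ˡ cells n f)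
  disjoint (_ , _ , refl) p∈cells = <-irrefl refl (proj₁ (proj₂ (∈-cells⁻ n p∈cells)))

-- The empty set contains no point, so including it never affects local width; it is the extra one
-- in the cardinality.
cellFamily : ∀ n → (ℕ → ℕ → Bool) → Family n
cellFamily n f = record
  { members  = ⊥ ∷ map (uncurry seg) (cells n f)
  ; distinct = All.tabulate (λ U∈ → nonempty (∈-map⁻ _ U∈)) ∷
               map-unique (λ u v → inj u v) (cells-unique n f)
  }
  where
  nonempty : ∀ {U} → (∃ λ p → p ∈ˡ cells n f × U ≡ uncurry seg p) → ⊥ ≢ U
  nonempty ((i , j) , p∈ , refl) ⊥≡seg with i≤j , j<n , _ ← ∈-cells⁻ n p∈ =
    ∉⊥ (subst (fromℕ< j<n ∈_) (sym ⊥≡seg) (∈-seg⁺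
      (≤-trans i≤j (≤-reflexive (sym (toℕ-fromℕ< j<n)))) (≤-reflexive (toℕ-fromℕ< j<n))))
  inj : ∀ {p q} → p ∈ˡ cells n f → q ∈ˡ cells n f → uncurry (seg {n}) p ≡ uncurry seg q → p ≡ q
  inj p∈ q∈ eq with i≤j , j<n , _ ← ∈-cells⁻ n p∈ | x≤y , y<n , _ ← ∈-cells⁻ n q∈
               with refl , refl ← seg-injective i≤j j<n x≤y y<n eq = refl

∈-cellFamily⁻ : {U : Subset n} → U ∈ᶠ cellFamily n f →
                U ≡ ⊥ ⊎ ∃₂ λ i j → i ≤ j × j < n × f i j ≡ true × U ≡ seg i j
∈-cellFamily⁻ (here U≡⊥) = inj₁ U≡⊥
∈-cellFamily⁻ {n} (there U∈) with (i , j) , p∈ , refl ← ∈-map⁻ _ U∈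
                             with i≤j , j<n , fij ← ∈-cells⁻ n p∈ = inj₂ (i , j , i≤j , j<n , fij , refl)

card-cellFamily : ∀ n f → card (cellFamily n f) ≡ suc (total n f)
card-cellFamily n f = cong suc (trans (length-map _ (cells n f)) (length-cells n f))

-- From chains to antichains, and the upper bound for families.

chainSegs : Chain n f c i j m → List (Subset n)
chainSegs [] = []
chainSegs (cons {x = x} {y = y} _ _ _ _ _ ch) = seg x y ∷ chainSegs ch

length-chainSegs : (ch : Chain n f c i j m) → length (chainSegs ch) ≡ m
length-chainSegs [] = refl
length-chainSegs (cons _ _ _ _ _ ch) = cong suc (length-chainSegs ch)

∈-chainSegs⁻ : ∀ {U} (ch : Chain n f c i j m) → U ∈ˡ chainSegs ch →
               ∃₂ λ a b → U ≡ seg a b × i ≤ a × a ≤ c × j ≤ b × b < n × f a b ≡ true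
∈-chainSegs⁻ (cons i≤x x≤c j≤y y<n fxy ch) (here refl) = _ , _ , refl , i≤x , x≤c , j≤y , y<n , fxy
∈-chainSegs⁻ (cons i≤x x≤c j≤y y<n fxy ch) (there U∈)
  with a , b , U≡ , x<a , a≤c , y<b , b<n , fab ← ∈-chainSegs⁻ ch U∈ =
  a , b , U≡ , ≤-trans i≤x (<⇒≤ x<a) , a≤c , ≤-trans j≤y (<⇒≤ y<b) , b<n , fab

-- Along a chain both end points move strictly right, which rules out inclusion either way. Columns
-- `≤ c` and rows `≥ c` keep the segments nonempty, as comparing end points requires.
head-incomparable : ∀ {U} (ch : Chain n f c (suc x) (suc y) m) → x ≤ c → c ≤ y → y < n →
                    U ∈ˡ chainSegs ch → ¬ (seg x y ⊆ U) × ¬ (U ⊆ seg x y)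
head-incomparable {c = c} ch x≤c c≤y y<n U∈
  with a , b , refl , x<a , a≤c , y<b , b<n , _ ← ∈-chainSegs⁻ ch U∈ =
  (λ sub → <⇒≱ x<a (proj₁ (seg-⊆⁻ (≤-trans x≤c c≤y) y<n sub))) ,
  (λ sub → <⇒≱ y<b (proj₂ (seg-⊆⁻ (≤-trans a≤c (≤-trans c≤y (<⇒≤ y<b))) b<n sub)))

chainSegs-antichain : (ch : Chain n f c i j m) → c ≤ j → ∀ {U V} →
                      U ∈ˡ chainSegs ch → V ∈ˡ chainSegs ch → U ⊆ V → U ≡ V
chainSegs-antichain (cons i≤x x≤c j≤y y<n _ ch) c≤j (here refl) (here refl) _ = refl
chainSegs-antichain (cons i≤x x≤c j≤y y<n _ ch) c≤j (here refl) (there V∈) sub =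
  ⊥-elim (proj₁ (head-incomparable ch x≤c (≤-trans c≤j j≤y) y<n V∈) sub)
chainSegs-antichain (cons i≤x x≤c j≤y y<n _ ch) c≤j (there U∈) (here refl) sub =
  ⊥-elim (proj₂ (head-incomparable ch x≤c (≤-trans c≤j j≤y) y<n U∈) sub)
chainSegs-antichain (cons i≤x x≤c j≤y y<n _ ch) c≤j (there U∈) (there V∈) sub =
  chainSegs-antichain ch (≤-trans c≤j (≤-trans j≤y (n≤1+n _))) U∈ V∈ sub

chainSegs-unique : (ch : Chain n f c i j m) → c ≤ j → Unique (chainSegs ch)
chainSegs-unique [] c≤j = []
chainSegs-unique (cons i≤x x≤c j≤y y<n _ ch) c≤j =
  All.tabulate (λ U∈ eq → proj₁ (head-incomparable ch x≤c (≤-trans c≤j j≤y) y<n U∈)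
                                (subst (_ ∈_) eq)) ∷
  chainSegs-unique ch (≤-trans c≤j (≤-trans j≤y (n≤1+n _)))

module _ {n k : ℕ} (F : Family n) (wide : IsWideSegmentFamily k n F) where

  open DecMembership (≡-dec {n = n} Bool._≟_) using (_∈?_)

  shape : ℕ → ℕ → Bool
  shape i j = does (seg i j ∈? members F)

  shape⁻ : shape i j ≡ true → seg i j ∈ᶠ F
  shape⁻ {i} {j} = does⁻ (seg i j ∈? members F)

  -- A chain of `suc k` cells at `c` would be an antichain of `suc k` members through `c`; its first
  -- row shows that `c` is a point of `Fin n`.
  wide⇒noChain : NoChain k n shape
  wide⇒noChain c ch@(cons _ _ c≤y y<n _ _) =
    <-irrefl refl (subst (_≤ k) (length-chainSegs ch)
      (proj₂ wide (fromℕ< c<n) (record { members = chainSegs ch ; distinct = chainSegs-unique ch ≤-refl })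
        through (chainSegs-antichain ch ≤-refl)))
    where
    c<n : c < n
    c<n = ≤-<-trans c≤y y<n
    through : ∀ {U} → U ∈ˡ chainSegs ch → U ∈ᶠ F × fromℕ< c<n ∈ U
    through U∈ with a , b , refl , _ , a≤c , c≤b , _ , fab ← ∈-chainSegs⁻ ch U∈ =
      shape⁻ fab , ∈-seg⁺ (≤-trans a≤c (≤-reflexive (sym (toℕ-fromℕ< c<n))))
                          (≤-trans (≤-reflexive (toℕ-fromℕ< c<n)) c≤b)

  card≤wideBound : card F ≤ suc (wideBound k n)
  card≤wideBound = begin
    card F                        ≤⟨ pigeonhole {R = _≡_} (distinct F) (λ U∈ → _ , listed U∈ , refl)
                                       (λ _ _ p q → trans p (sym q)) ⟩
    card (cellFamily n shape)     ≡⟨ card-cellFamily n shape ⟩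
    suc (total n shape)           ≤⟨ s≤s (total≤wideBound k n shape wide⇒noChain) ⟩
    suc (wideBound k n)           ∎
    where
    open ≤-Reasoning
    listed : ∀ {U} → U ∈ᶠ F → U ∈ᶠ cellFamily n shape
    listed U∈ with segment-form (proj₁ wide U∈)
    ... | inj₁ refl = here refl
    ... | inj₂ (i , j , i≤j , j<n , refl) =
      there (∈-map⁺ (uncurry seg) (∈-cells⁺ n i≤j j<n (dec-true (seg i j ∈? members F) U∈)))

-- A family attaining the bound.

wideCells : ℕ → ℕ → ℕ → Bool
wideCells k i j = does (i <? k) ∨ does (j <? i + k)

wideCells⁺ : ∀ k i j → i < k ⊎ j < i + k → wideCells k i j ≡ true
wideCells⁺ k i j (inj₁ i<k) rewrite dec-true (i <? k) i<k = refl
wideCells⁺ k i j (inj₂ j<i+k) rewrite dec-true (j <? i + k) j<i+k = ∨-zeroʳ _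

wideCells⁻ : ∀ k i j → wideCells k i j ≡ true → i < k ⊎ j < i + k
wideCells⁻ k i j eq with i <? k | j <? i + k
... | yes i<k | _         = inj₁ i<k
... | no  i≮k | yes j<i+k = inj₂ j<i+k
... | no  i≮k | no  j≮i+k = contradiction
  (trans (sym eq) (cong₂ _∨_ (dec-false (i <? k) i≮k) (dec-false (j <? i + k) j≮i+k))) λ ()

-- Row `n` contains the first `k` and the last `k` of its `suc n` columns. If `n < 2k` these cover
-- the row; otherwise they are disjoint, with `e` columns between them whose count is dropped.
wideCells-rowCount : ∀ k n → suc n ⊓ (k + k) ≤ rowCount (wideCells k) n
wideCells-rowCount k n with suc n ≤? k + k
... | yes n<2k = ≤-trans (m⊓n≤m (suc n) (k + k)) (≤-reflexive (sym (count-full 0 (suc n) all)))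
  where
  all : ∀ i → 0 ≤ i → i < suc n → wideCells k i n ≡ true
  all i _ _ with i <? k
  ... | yes i<k = wideCells⁺ k i n (inj₁ i<k)
  ... | no  i≮k = wideCells⁺ k i n (inj₂ (≤-trans n<2k (+-monoˡ-≤ k (≮⇒≥ i≮k))))
... | no n≮2k = begin
  suc n ⊓ (k + k)                                    ≤⟨ m⊓n≤n (suc n) (k + k) ⟩
  k + k                                              ≡⟨ cong₂ _+_ (count-full 0 k low) (count-full (k + e) k high) ⟨
  count 0 k g₀ + count (k + e) k g₀                  ≤⟨ +-monoʳ-≤ (count 0 k g₀) (m≤n+m _ (count k e g₀)) ⟩
  count 0 k g₀ + (count k e g₀ + count (k + e) k g₀) ≡⟨ cong (count 0 k g₀ +_) (count-+ k e k) ⟨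
  count 0 k g₀ + count k (e + k) g₀                  ≡⟨ count-+ 0 k (e + k) ⟨
  count 0 (k + (e + k)) g₀                           ≡⟨ cong (λ r → count 0 r g₀) split ⟩
  rowCount (wideCells k) n                           ∎
  where
  open ≤-Reasoning
  g₀ = row (wideCells k) n
  e = suc n ∸ (k + k)
  split : k + (e + k) ≡ suc n
  split = trans (lemma k e) (m∸n+n≡m (≰⇒≥ n≮2k))
    where
    lemma : ∀ p q → p + (q + p) ≡ q + (p + p)
    lemma = solve-∀
  low : ∀ i → 0 ≤ i → i < k → g₀ i ≡ true
  low i _ i<k = wideCells⁺ k i n (inj₁ i<k)
  high : ∀ i → k + e ≤ i → i < k + e + k → g₀ i ≡ true
  high i k+e≤i _ = wideCells⁺ k i n (inj₂ (≤-trans (≤-reflexive (trans (sym split) (sym (+-assoc k e k))))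
                                                   (+-monoˡ-≤ k k+e≤i)))

wideBound≤total : ∀ k n → wideBound k n ≤ total n (wideCells k)
wideBound≤total k zero    = z≤n
wideBound≤total k (suc n) = +-mono-≤
  (≤-trans (wideCells-rowCount k n) (≤-reflexive (sym (*-identityˡ _)))) (wideBound≤total k n)

wideFamily : ∀ k n → Family n
wideFamily k n = cellFamily n (wideCells k)

Colour : Fin n → Subset n → ℕ → Set
Colour c U s = ∃₂ λ i j → U ≡ seg i j × i ≤ toℕ c × toℕ c ≤ j × i ⊓ (j ∸ toℕ c) ≡ s

-- The pairs with a given minimum form an L, a vertical ray followed by a horizontal one. Along it
-- the first coordinate rises and the second falls, both weakly. For the pairs `(i , j ∸ p)` of
-- segments through `p`, being so ordered means being nested.
same-min : a ⊓ b ≡ c ⊓ d → (a ≤ c × d ≤ b) ⊎ (c ≤ a × b ≤ d)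
same-min {a} {b} {c} {d} eq with ≤-total a b | ≤-total c d
... | inj₁ a≤b | inj₁ c≤d with refl ← trans (sym (m≤n⇒m⊓n≡m a≤b)) (trans eq (m≤n⇒m⊓n≡m c≤d)) with ≤-total b d
...   | inj₁ b≤d = inj₂ (≤-refl , b≤d)
...   | inj₂ d≤b = inj₁ (≤-refl , d≤b)
same-min eq | inj₁ a≤b | inj₂ d≤c with refl ← trans (sym (m≤n⇒m⊓n≡m a≤b)) (trans eq (m≥n⇒m⊓n≡n d≤c)) =
  inj₁ (d≤c , a≤b)
same-min eq | inj₂ b≤a | inj₁ c≤d with refl ← trans (sym (m≥n⇒m⊓n≡n b≤a)) (trans eq (m≤n⇒m⊓n≡m c≤d)) =
  inj₂ (b≤a , c≤d)
same-min {a} {b} {c} {d} eq | inj₂ b≤a | inj₂ d≤c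
  with refl ← trans (sym (m≥n⇒m⊓n≡n b≤a)) (trans eq (m≥n⇒m⊓n≡n d≤c)) with ≤-total a c
...   | inj₁ a≤c = inj₁ (a≤c , ≤-refl)
...   | inj₂ c≤a = inj₂ (c≤a , ≤-refl)

∸-cancel-≤ : c ≤ i → c ≤ j → i ∸ c ≤ j ∸ c → i ≤ j
∸-cancel-≤ {c} c≤i c≤j i-c≤j-c =
  subst₂ _≤_ (m∸n+n≡m c≤i) (m∸n+n≡m c≤j) (+-monoˡ-≤ c i-c≤j-c)

colour-injective : ∀ (A : Family n) {p : Fin n} {U V s} → IsAntichain A → U ∈ᶠ A → V ∈ᶠ A →
                   Colour p U s → Colour p V s → U ≡ V
colour-injective A anti U∈ V∈ (i , j , refl , i≤p , p≤j , eq) (i′ , j′ , refl , i′≤p , p≤j′ , eq′)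
  with same-min {i} (trans eq (sym eq′))
... | inj₁ (i≤i′ , d′≤d) = sym (anti V∈ U∈ (seg-⊆ i≤i′ (∸-cancel-≤ p≤j′ p≤j d′≤d)))
... | inj₂ (i′≤i , d≤d′) = anti U∈ V∈ (seg-⊆ i′≤i (∸-cancel-≤ p≤j p≤j′ d≤d′))

wideFamily-wide : ∀ k n → IsWideSegmentFamily k n (wideFamily k n)
wideFamily-wide k n = (λ U∈ → isSegment (∈-cellFamily⁻ U∈)) , λ p A through anti → begin
  card A             ≤⟨ pigeonhole {R = Colour p} (distinct A)
                          (λ U∈ → colour p (proj₂ (through U∈)) (∈-cellFamily⁻ (proj₁ (through U∈))))
                          (λ U∈ V∈ → colour-injective A anti U∈ V∈) ⟩
  length (upTo k)    ≡⟨ length-upTo k ⟩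
  k                  ∎
  where
  open ≤-Reasoning
  Form : Subset n → Set
  Form U = U ≡ ⊥ ⊎ ∃₂ λ i j → i ≤ j × j < n × wideCells k i j ≡ true × U ≡ seg i j

  isSegment : ∀ {U} → Form U → IsSegment U
  isSegment (inj₁ refl) = ⊥-isSegment
  isSegment (inj₂ (i , j , _ , j<n , _ , refl)) = seg-isSegment j<n

  colour<k : ∀ {p} i j → i ≤ p → p ≤ j → i < k ⊎ j < i + k → i ⊓ (j ∸ p) < k
  colour<k {p} i j _ _ (inj₁ i<k) = ≤-<-trans (m⊓n≤m i (j ∸ p)) i<k
  -- Since `i ≤ p`, the distance `j ∸ p` is at most `j ∸ i`, which is below `k`.
  colour<k {p} i j i≤p p≤j (inj₂ j<i+k) = ≤-<-trans (m⊓n≤n i (j ∸ p))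
    (+-cancelʳ-< p (j ∸ p) k (begin-strict
      j ∸ p + p  ≡⟨ m∸n+n≡m p≤j ⟩
      j          <⟨ j<i+k ⟩
      i + k      ≤⟨ +-monoˡ-≤ k i≤p ⟩
      p + k      ≡⟨ +-comm p k ⟩
      k + p      ∎))

  colour : ∀ p {U} → p ∈ U → Form U → ∃ λ s → s ∈ˡ upTo k × Colour p U s
  colour p p∈ (inj₁ refl) = contradiction p∈ ∉⊥
  colour p p∈ (inj₂ (i , j , _ , _ , ij , refl)) with i≤p , p≤j ← ∈-seg⁻ p∈ =
    _ , ∈-upTo⁺ (colour<k i j i≤p p≤j (wideCells⁻ k i j ij)) , i , j , refl , i≤p , p≤j , refl

-- The maximum and its recursion.

wideBound-isMaxCard : ∀ k n → IsMaxCard (IsWideSegmentFamily k n) (suc (wideBound k n))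
wideBound-isMaxCard k n =
  ( wideFamily k n , wideFamily-wide k n
  , ≤-antisym (card≤wideBound (wideFamily k n) (wideFamily-wide k n))
      (≤-trans (s≤s (wideBound≤total k n)) (≤-reflexive (sym (card-cellFamily n (wideCells k))))))
  , card≤wideBound

isMaxCard-unique : {P : Family n → Set} → IsMaxCard P a → IsMaxCard P b → a ≡ b
isMaxCard-unique ((F , PF , refl) , F-max) ((G , PG , refl) , G-max) =
  ≤-antisym (G-max F PF) (F-max G PG)

wideBound-zero : ∀ n → wideBound 0 n ≡ 0
wideBound-zero zero    = refl
wideBound-zero (suc n) = wideBound-zero n

-- Raising `k` by one and shifting rows by two adds two to each minimum, as `(j + 3) ⊓ (2k + 2)`
-- equals `2 + ((j + 1) ⊓ 2k)`. The first two rows contribute the `3`.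
wideBound-suc : ∀ k n → wideBound (suc k) (2 + n) ≡ n + n + 3 + wideBound k n
wideBound-suc k zero rewrite +-suc k k = refl
wideBound-suc k (suc n) rewrite wideBound-suc k n | +-suc k k =
  lemma n (suc n ⊓ (k + k)) (wideBound k n)
  where
  lemma : ∀ p q r → suc (suc q) + (p + p + 3 + r) ≡ suc p + suc p + 3 + (q + r)
  lemma = solve-∀

theorem3p6p6 : (∀ k n → ∃ λ m → IsMaxCard (IsWideSegmentFamily k n) m) ×
    ((S : ℕ → ℕ → ℕ) →
    (∀ k n → IsMaxCard (IsWideSegmentFamily k n) (S k n)) →
    (∀ k → S k 0 ≡ 1) ×
    (∀ n → S 0 n ≡ 1) ×
    (∀ k → 1 ≤ k → S k 1 ≡ 2) ×
    (∀ k n → 1 ≤ k → 2 ≤ n → S k n ≡ (2 * n ∸ 1) + S (k ∸ 1) (n ∸ 2)))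
theorem3p6p6 = (λ k n → _ , wideBound-isMaxCard k n) , λ S S-max →
  let value : ∀ k n → S k n ≡ suc (wideBound k n)
      value k n = isMaxCard-unique (S-max k n) (wideBound-isMaxCard k n)
  in (λ k → value k 0)
   , (λ n → trans (value 0 n) (cong suc (wideBound-zero n)))
   , (λ { (suc k) _ → trans (value (suc k) 1) refl })
   , (λ { (suc k) (suc (suc n)) _ (s≤s (s≤s z≤n)) → begin
       S (suc k) (2 + n)                       ≡⟨ value (suc k) (2 + n) ⟩
       suc (wideBound (suc k) (2 + n))         ≡⟨ cong suc (wideBound-suc k n) ⟩
       suc (n + n + 3 + wideBound k n)         ≡⟨ +-suc (n + n + 3) (wideBound k n) ⟨
       n + n + 3 + suc (wideBound k n)         ≡⟨ cong₂ _+_ (cong (_∸ 1) (double n)) (sym (value k n)) ⟩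
       (2 * (2 + n) ∸ 1) + S k n               ∎ })
  where
  open ≡-Reasoning
  -- Stated one higher, so that `_∸ 1` strips the `suc` by computation.
  double : ∀ n → suc (n + n + 3) ≡ 2 * (2 + n)
  double = solve-∀
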